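{- The algebra $\mathsf{List}(A)$ is initial: for every algebra $X : \mathsf{Alg}$ there is a unique algebra morphism from $\mathsf{List}(A)$ to $X$.
   Context: Setting: linear dependent type theory with cartesian unit, $\prod$, $\sum$ and extensional identity types (with equality reflection); linear connectives $\multimap$, $\otimes$, $!$; linear dependent products $\prod^{\mathrm{lin}}_{x:B} C$ (the linear analogue of $\prod$, with cartesian index type $B$ and linear codomain); a modality $\mathsf{M}$ from linear to cartesian types/terms (applied to terms in the empty linear context), with inverse $\mu$, assumed injective; linear equalizer types $\mathrm{Eq}(f,g)$; and an impredicative universe $\mathcal{U}$ with decodings $\mathrm{El}_C$ and $\mathrm{El}_L$, closed under large cartesian and linear dependent products, linear functions and equalizers. For linear terms in the empty linear context, $a =_L a'$ means $\mathsf{M}(a)=\mathsf{M}(a')$. Let $A$ be a closed linear type. Define $\mathsf{List}^*(A) :\equiv \prod^{\mathrm{lin}}_{X:\mathcal{U}} \big(\mathrm{El}_L(X) \multimap\, !(A\multimap \mathrm{El}_L(X)\multimap \mathrm{El}_L(X)) \multimap \mathrm{El}_L(X)\big)$, $\mathsf{nil}^* :\equiv \lambda X\,n\,c.\,n$, $\mathsf{cons}^*(a,l) :\equiv \lambda X\,n\,c.\,c\,a\,(l\,X\,n\,c)$, and $\mathrm{rec}(X,n,c,l) :\equiv l\,X\,n\,c$. Algebras: $\mathsf{Alg} :\equiv \sum_{X:\mathcal{U}} \mathsf{M}(\mathrm{El}_L(X)) \times \mathsf{M}(!(A\multimap \mathrm{El}_L(X)\multimap \mathrm{El}_L(X)))$,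 with structure maps $n_X, c_X$. An algebra morphism $X\to Y$ is an element of $\mathrm{Mor}(X,Y) :\equiv \sum (f : \mathsf{M}(\mathrm{El}_L(X)\multimap \mathrm{El}_L(Y))).\, (f\,n_X =_L n_Y) \times \prod (a:A)(x:X).\, f(c_X\,a\,x) =_L c_Y\,a\,(f\,x)$. Define $\varphi,\psi : \mathsf{List}^*(A) \multimap \prod^{\mathrm{lin}}_{(X,n_X,c_X):\mathsf{Alg}} \prod^{\mathrm{lin}}_{(Y,n_Y,c_Y):\mathsf{Alg}} \prod^{\mathrm{lin}}_{(f,p,q):\mathrm{Mor}(X,Y)} \mathrm{El}_L(Y)$ by $\varphi :\equiv \lambda l\ldots.\, f(\mathrm{rec}(X,n_X,c_X,l))$ and $\psi :\equiv \lambda l\ldots.\, \mathrm{rec}(Y,n_Y,c_Y,l)$, and $\mathsf{List}(A) :\equiv \mathrm{Eq}(\varphi,\psi)$. Since $\varphi$ and $\psi$ agree on $\mathsf{nil}^*$ and on $\mathsf{cons}^*(a,l)$ for $l$ in the equalizer, one obtains $\mathsf{nil} : \mathsf{List}(A)$ and $\mathsf{cons}(a,l) : \mathsf{List}(A)$, making $\mathsf{List}(A)$ an algebra with carrier $\mathsf{List}(A)$ and structure $\mathsf{nil}$, $\mathsf{cons}$.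
   Formalization: Injectivity of M is required also for terms with free linear variables (linear maps are determined by their values on closed terms), and φ, ψ use the promotion of the function underlying c_X instead of the component of type !(A⊸X⊸X); otherwise uniqueness, or cons on List(A), can fail. -}

module Defs where

open import Level using (Level; suc)
open import Axiom.Extensionality.Propositional using (Extensionality)
open import Data.List.Base using (List; []; _∷_; [_]; _++_)
open import Data.List.Relation.Unary.All using (All; []; _∷_)
open import Data.List.Relation.Unary.All.Properties using (++⁺)
open import Data.List.Relation.Binary.Permutation.Propositional
  using (_↭_; refl; prep; swap; trans)
open import Data.List.Relation.Binary.Permutation.Propositional.Properties
  using (All-resp-↭)
open import Data.Product.Base using (∃; _,_; proj₁; proj₂)
open import Relation.Binary.PropositionalEquality
  using (_≡_; refl; sym; cong; cong₂; subst; module ≡-Reasoning)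

-- Linear dependent type theory, presented in the style of a logical framework.
-- Cartesian contexts are Agda contexts: a cartesian binder is an Agda function,
-- and cartesian weakening and substitution are those of Agda.  Linear contexts
-- are explicit lists.  Judgemental equality is _≡_, and `funext` is its
-- congruence rule under cartesian binders.
--
-- A linear term may be instantiated by closed linear terms (_⟪_⟫), and the
-- computation rules are stated through such instances.  The usual open rules
-- follow from these by 𝕞-injective, substitution of an open linear term u
-- for the first variable of t being  ƛ t $ u.

record LDTT (ℓ : Level) : Set (suc ℓ) where

  infix  5 _,⊗_
  infixr 6 _⊸_
  infixr 7 _⊗_
  infix  8 !_
  infixl 8 _$_ _·_ _∙_
  infix  9 _⟪_⟫
  infix  3 _⊢_

  field
    funext : Extensionality ℓ ℓ

    Ty : Set ℓ
    Tm : Ty → Set ℓ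

    𝟙   : Ty
    tt  : Tm 𝟙
    𝟙-η : (x : Tm 𝟙) → x ≡ tt

    Π   : (A : Ty) → (Tm A → Ty) → Ty
    fun : ∀ {A B} → ((x : Tm A) → Tm (B x)) → Tm (Π A B)
    _∙_ : ∀ {A B} → Tm (Π A B) → (x : Tm A) → Tm (B x)
    Π-β : ∀ {A B} (t : (x : Tm A) → Tm (B x)) (x : Tm A) → fun {A} {B} t ∙ x ≡ t x
    Π-η : ∀ {A B} (t : Tm (Π A B)) → fun (λ x → t ∙ x) ≡ t

    Σ    : (A : Ty) → (Tm A → Ty) → Ty
    pair : ∀ {A B} (x : Tm A) → Tm (B x) → Tm (Σ A B)
    fst  : ∀ {A B} → Tm (Σ A B) → Tm A
    snd  : ∀ {A B} (p : Tm (Σ A B)) → Tm (B (fst p))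
    Σ-β₁ : ∀ {A B} (x : Tm A) (y : Tm (B x)) → fst (pair {A} {B} x y) ≡ x
    Σ-β₂ : ∀ {A B} (x : Tm A) (y : Tm (B x)) →
           subst (λ z → Tm (B z)) (Σ-β₁ x y) (snd (pair {A} {B} x y)) ≡ y
    Σ-η  : ∀ {A B} (p : Tm (Σ A B)) → pair (fst p) (snd p) ≡ p

    Id      : ∀ {A} → Tm A → Tm A → Ty
    rfl     : ∀ {A} (x : Tm A) → Tm (Id x x)
    reflect : ∀ {A} {x y : Tm A} → Tm (Id x y) → x ≡ y
    Id-η    : ∀ {A} {x y : Tm A} (p q : Tm (Id x y)) → p ≡ q

    LTy : Set ℓ
    _⊢_ : List LTy → LTy → Set ℓ

  Env : List LTy → Set ℓ
  Env = All ([] ⊢_)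

  field
    _⟪_⟫ : ∀ {Ξ A} → Ξ ⊢ A → Env Ξ → [] ⊢ A
    ⟪[]⟫ : ∀ {A} (t : [] ⊢ A) → t ⟪ [] ⟫ ≡ t

    var     : ∀ {A} → [ A ] ⊢ A
    var-⟪⟫  : ∀ {A} (a : [] ⊢ A) → var ⟪ a ∷ [] ⟫ ≡ a
    exch    : ∀ {Ξ Ξ′ A} → Ξ ↭ Ξ′ → Ξ ⊢ A → Ξ′ ⊢ A
    exch-⟪⟫ : ∀ {Ξ Ξ′ A} (π : Ξ ↭ Ξ′) (t : Ξ ⊢ A) (γ : Env Ξ) →
              exch π t ⟪ All-resp-↭ π γ ⟫ ≡ t ⟪ γ ⟫

    _⊸_  : LTy → LTy → LTy
    ƛ    : ∀ {Ξ A B} → A ∷ Ξ ⊢ B → Ξ ⊢ A ⊸ B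
    _$_  : ∀ {Ξ Δ A B} → Ξ ⊢ A ⊸ B → Δ ⊢ A → Ξ ++ Δ ⊢ B
    $-⟪⟫ : ∀ {Ξ Δ A B} (t : Ξ ⊢ A ⊸ B) (u : Δ ⊢ A) (γ : Env Ξ) (δ : Env Δ) →
           (t $ u) ⟪ ++⁺ γ δ ⟫ ≡ t ⟪ γ ⟫ $ u ⟪ δ ⟫
    ⊸-β  : ∀ {Ξ A B} (t : A ∷ Ξ ⊢ B) (γ : Env Ξ) (a : [] ⊢ A) →
           ƛ t ⟪ γ ⟫ $ a ≡ t ⟪ a ∷ γ ⟫
    ⊸-η  : ∀ {A B} (t : [] ⊢ A ⊸ B) → ƛ (t $ var) ≡ t

    _⊗_     : LTy → LTy → LTy
    _,⊗_    : ∀ {Ξ Δ A B} → Ξ ⊢ A → Δ ⊢ B → Ξ ++ Δ ⊢ A ⊗ B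
    let⊗    : ∀ {Ξ Δ A B C} → Ξ ⊢ A ⊗ B → A ∷ B ∷ Δ ⊢ C → Ξ ++ Δ ⊢ C
    ,⊗-⟪⟫   : ∀ {Ξ Δ A B} (t : Ξ ⊢ A) (u : Δ ⊢ B) (γ : Env Ξ) (δ : Env Δ) →
              (t ,⊗ u) ⟪ ++⁺ γ δ ⟫ ≡ t ⟪ γ ⟫ ,⊗ u ⟪ δ ⟫
    let⊗-⟪⟫ : ∀ {Ξ Δ A B C} (s : Ξ ⊢ A ⊗ B) (t : A ∷ B ∷ Δ ⊢ C)
              (γ : Env Ξ) (δ : Env Δ) →
              let⊗ s t ⟪ ++⁺ γ δ ⟫ ≡ let⊗ (s ⟪ γ ⟫) t ⟪ δ ⟫
    ⊗-β     : ∀ {Δ A B C} (a : [] ⊢ A) (b : [] ⊢ B) (t : A ∷ B ∷ Δ ⊢ C)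
              (δ : Env Δ) → let⊗ (a ,⊗ b) t ⟪ δ ⟫ ≡ t ⟪ a ∷ b ∷ δ ⟫
    ⊗-η     : ∀ {A B C} (k : [] ⊢ A ⊗ B ⊸ C) (s : [] ⊢ A ⊗ B) →
              let⊗ s (k $ (var ,⊗ var)) ≡ k $ s

    -- For empty Ξ, 𝕞-injective is injectivity of 𝕞 on closed linear terms.  For
    -- general Ξ it says that 𝕞 is injective also on linear terms with free
    -- variables, i.e. on the terms obtained by replacing each variable a : A of
    -- Ξ by μ x for a cartesian variable x : M A.  The general form is needed: if
    -- linear maps are not determined by their values on closed terms, the
    -- morphisms out of the algebra of lists need not be unique.

    M    : LTy → Ty
    𝕞    : ∀ {A} → [] ⊢ A → Tm (M A)
    μ    : ∀ {A} → Tm (M A) → [] ⊢ A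
    𝕞-μ  : ∀ {A} (x : Tm (M A)) → 𝕞 (μ x) ≡ x
    μ-𝕞  : ∀ {A} (a : [] ⊢ A) → μ (𝕞 a) ≡ a
    𝕞-injective : ∀ {Ξ A} (t u : Ξ ⊢ A) →
                  ((γ : Env Ξ) → 𝕞 (t ⟪ γ ⟫) ≡ 𝕞 (u ⟪ γ ⟫)) → t ≡ u

    !_      : LTy → LTy
    bang    : ∀ {A} → [] ⊢ A → [] ⊢ ! A
    let!    : ∀ {Ξ Δ A B} → Ξ ⊢ ! A → (Tm (M A) → Δ ⊢ B) → Ξ ++ Δ ⊢ B
    let!-⟪⟫ : ∀ {Ξ Δ A B} (s : Ξ ⊢ ! A) (t : Tm (M A) → Δ ⊢ B)
              (γ : Env Ξ) (δ : Env Δ) →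
              let! s t ⟪ ++⁺ γ δ ⟫ ≡ let! (s ⟪ γ ⟫) (λ x → t x ⟪ δ ⟫)
    !-β     : ∀ {Δ A B} (a : [] ⊢ A) (t : Tm (M A) → Δ ⊢ B) →
              let! (bang a) t ≡ t (𝕞 a)
    !-η     : ∀ {A B} (k : [] ⊢ ! A ⊸ B) (s : [] ⊢ ! A) →
              let! s (λ x → k $ bang (μ x)) ≡ k $ s

    Πˡ   : (B : Ty) → (Tm B → LTy) → LTy
    Λ    : ∀ {Ξ B C} → ((x : Tm B) → Ξ ⊢ C x) → Ξ ⊢ Πˡ B C
    _·_  : ∀ {Ξ B C} → Ξ ⊢ Πˡ B C → (x : Tm B) → Ξ ⊢ C x
    Λ-⟪⟫ : ∀ {Ξ B C} (t : (x : Tm B) → Ξ ⊢ C x) (γ : Env Ξ) →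
           Λ {Ξ} {B} {C} t ⟪ γ ⟫ ≡ Λ (λ x → t x ⟪ γ ⟫)
    ·-⟪⟫ : ∀ {Ξ B C} (t : Ξ ⊢ Πˡ B C) (x : Tm B) (γ : Env Ξ) →
           (t · x) ⟪ γ ⟫ ≡ t ⟪ γ ⟫ · x
    Πˡ-β : ∀ {Ξ B C} (t : (x : Tm B) → Ξ ⊢ C x) (x : Tm B) →
           Λ {Ξ} {B} {C} t · x ≡ t x
    Πˡ-η : ∀ {Ξ B C} (t : Ξ ⊢ Πˡ B C) → Λ (λ x → t · x) ≡ t

    Eq    : ∀ {A B} → [] ⊢ A ⊸ B → [] ⊢ A ⊸ B → LTy
    eq    : ∀ {Ξ A B} {f g : [] ⊢ A ⊸ B} (t : Ξ ⊢ A) → f $ t ≡ g $ t → Ξ ⊢ Eq f g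
    ι     : ∀ {Ξ A B} {f g : [] ⊢ A ⊸ B} → Ξ ⊢ Eq f g → Ξ ⊢ A
    Eq-eq : ∀ {Ξ A B} {f g : [] ⊢ A ⊸ B} (e : Ξ ⊢ Eq f g) → f $ ι e ≡ g $ ι e
    ι-⟪⟫  : ∀ {Ξ A B} {f g : [] ⊢ A ⊸ B} (e : Ξ ⊢ Eq f g) (γ : Env Ξ) →
            ι e ⟪ γ ⟫ ≡ ι (e ⟪ γ ⟫)
    Eq-β  : ∀ {Ξ A B} {f g : [] ⊢ A ⊸ B} (t : Ξ ⊢ A) (p : f $ t ≡ g $ t) →
            ι (eq t p) ≡ t
    Eq-η  : ∀ {Ξ A B} {f g : [] ⊢ A ⊸ B} (e : Ξ ⊢ Eq f g) → eq (ι e) (Eq-eq e) ≡ e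

    -- Impredicativity: the index type of a small product and the domain of a
    -- small linear function type are arbitrary.  Only equalizers of maps
    -- between small types are required to be small.

    U   : Ty
    Elᶜ : Tm U → Ty
    Elˡ : Tm U → LTy

    Πᵁ     : (B : Ty) → (Tm B → Tm U) → Tm U
    Elᶜ-Π  : ∀ B C → Elᶜ (Πᵁ B C) ≡ Π B (λ x → Elᶜ (C x))
    Πˡᵁ    : (B : Ty) → (Tm B → Tm U) → Tm U
    Elˡ-Πˡ : ∀ B C → Elˡ (Πˡᵁ B C) ≡ Πˡ B (λ x → Elˡ (C x))
    _⊸ᵁ_   : LTy → Tm U → Tm U
    Elˡ-⊸  : ∀ A X → Elˡ (A ⊸ᵁ X) ≡ A ⊸ Elˡ X
    Eqᵁ    : ∀ {X Y} → [] ⊢ Elˡ X ⊸ Elˡ Y → [] ⊢ Elˡ X ⊸ Elˡ Y → Tm U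
    Elˡ-Eq : ∀ {X Y} (f g : [] ⊢ Elˡ X ⊸ Elˡ Y) → Elˡ (Eqᵁ f g) ≡ Eq f g

  infixr 5 _×_
  _×_ : Ty → Ty → Ty
  A × B = Σ A (λ _ → B)

  infix 4 _=ᴸ_
  _=ᴸ_ : ∀ {A} → [] ⊢ A → [] ⊢ A → Ty
  a =ᴸ a′ = Id (𝕞 a) (𝕞 a′)

  isContr : Ty → Ty
  isContr A = Σ A (λ x → Π A (λ y → Id y x))

  derelict : ∀ {A} → [] ⊢ ! A → [] ⊢ A
  derelict s = let! s μ

  Small : LTy → Set ℓ
  Small A = ∃ λ X → Elˡ X ≡ A

  small-Πˡ : ∀ {B C} → ((x : Tm B) → Small (C x)) → Small (Πˡ B C)
  small-Πˡ {B} {C} s = Πˡᵁ B (λ x → proj₁ (s x)) , (begin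
    Elˡ (Πˡᵁ B (λ x → proj₁ (s x))) ≡⟨ Elˡ-Πˡ _ _ ⟩
    Πˡ B (λ x → Elˡ (proj₁ (s x)))  ≡⟨ cong (Πˡ B) (funext (λ x → proj₂ (s x))) ⟩
    Πˡ B C                          ∎)
    where open ≡-Reasoning

  small-⊸ : ∀ {A B} → Small B → Small (A ⊸ B)
  small-⊸ {A} (X , refl) = (A ⊸ᵁ X) , Elˡ-⊸ A X

  small-Eq : ∀ {A B} (f g : [] ⊢ A ⊸ B) → Small A → Small B → Small (Eq f g)
  small-Eq f g (X , refl) (Y , refl) = Eqᵁ f g , Elˡ-Eq f g

  𝕞-inj : ∀ {A} {a b : [] ⊢ A} → 𝕞 a ≡ 𝕞 b → a ≡ b
  𝕞-inj {a = a} {b} p = begin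
    a       ≡⟨ sym (μ-𝕞 a) ⟩
    μ (𝕞 a) ≡⟨ cong μ p ⟩
    μ (𝕞 b) ≡⟨ μ-𝕞 b ⟩
    b       ∎
    where open ≡-Reasoning

  pointwise : ∀ {Ξ A} {t u : Ξ ⊢ A} → ((γ : Env Ξ) → t ⟪ γ ⟫ ≡ u ⟪ γ ⟫) → t ≡ u
  pointwise h = 𝕞-injective _ _ (λ γ → cong 𝕞 (h γ))

  Πˡ-ext : ∀ {Ξ B C} {t u : Ξ ⊢ Πˡ B C} → (∀ x → t · x ≡ u · x) → t ≡ u
  Πˡ-ext {t = t} {u} h = begin
    t               ≡⟨ sym (Πˡ-η t) ⟩
    Λ (λ x → t · x) ≡⟨ cong Λ (funext h) ⟩
    Λ (λ x → u · x) ≡⟨ Πˡ-η u ⟩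
    u               ∎
    where open ≡-Reasoning

  β : ∀ {A B} (t : [ A ] ⊢ B) (a : [] ⊢ A) → ƛ t $ a ≡ t ⟪ a ∷ [] ⟫
  β t a = begin
    ƛ t $ a           ≡⟨ cong (_$ a) (sym (⟪[]⟫ (ƛ t))) ⟩
    ƛ t ⟪ [] ⟫ $ a    ≡⟨ ⊸-β t [] a ⟩
    t ⟪ a ∷ [] ⟫      ∎
    where open ≡-Reasoning

  β₂ : ∀ {A B C} (t : B ∷ A ∷ [] ⊢ C) (a : [] ⊢ A) (b : [] ⊢ B) →
       ƛ (ƛ t) $ a $ b ≡ t ⟪ b ∷ a ∷ [] ⟫
  β₂ t a b = begin
    ƛ (ƛ t) $ a $ b       ≡⟨ cong (_$ b) (β (ƛ t) a) ⟩
    ƛ t ⟪ a ∷ [] ⟫ $ b    ≡⟨ ⊸-β t (a ∷ []) b ⟩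
    t ⟪ b ∷ a ∷ [] ⟫      ∎
    where open ≡-Reasoning

  Πˡ-β-⟪⟫ : ∀ {Ξ B} C (t : (x : Tm B) → Ξ ⊢ C x) (γ : Env Ξ) (x : Tm B) →
            Λ {C = C} t ⟪ γ ⟫ · x ≡ t x ⟪ γ ⟫
  Πˡ-β-⟪⟫ C t γ x = begin
    Λ {C = C} t ⟪ γ ⟫ · x     ≡⟨ sym (·-⟪⟫ (Λ t) x γ) ⟩
    (Λ {C = C} t · x) ⟪ γ ⟫   ≡⟨ cong _⟪ γ ⟫ (Πˡ-β t x) ⟩
    t x ⟪ γ ⟫                 ∎
    where open ≡-Reasoning

  closed$-⟪⟫ : ∀ {Ξ A B} (f : [] ⊢ A ⊸ B) (t : Ξ ⊢ A) (γ : Env Ξ) →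
               (f $ t) ⟪ γ ⟫ ≡ f $ t ⟪ γ ⟫
  closed$-⟪⟫ f t γ = begin
    (f $ t) ⟪ γ ⟫       ≡⟨ $-⟪⟫ f t [] γ ⟩
    f ⟪ [] ⟫ $ t ⟪ γ ⟫  ≡⟨ cong (_$ _) (⟪[]⟫ f) ⟩
    f $ t ⟪ γ ⟫         ∎
    where open ≡-Reasoning

module Lists {ℓ} (T : LDTT ℓ) (A : LDTT.LTy T) where

  open LDTT T
  open ≡-Reasoning

  Step : LTy → LTy
  Step Z = A ⊸ Z ⊸ Z

  List* : LTy
  List* = Πˡ U (λ X → Elˡ X ⊸ ! Step (Elˡ X) ⊸ Elˡ X)

  rec : ∀ {Ξ Δ Θ} (X : Tm U) → Δ ⊢ Elˡ X → Θ ⊢ ! Step (Elˡ X) → Ξ ⊢ List* →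
        (Ξ ++ Δ) ++ Θ ⊢ Elˡ X
  rec X n c l = l · X $ n $ c

  nil* : [] ⊢ List*
  nil* = Λ λ X → ƛ (ƛ (let! var (λ _ → var)))

  -- λ a l X n c. let !c′ = c in c′ a (l X n !c′): the variable c is used twice.
  -- The permutation brings  a, l, n  into the order  n, l, a.
  consBody : (X : Tm U) → [] ⊢ Step (Elˡ X) → Elˡ X ∷ List* ∷ A ∷ [] ⊢ Elˡ X
  consBody X c = exch π (c $ var $ rec X var (bang c) var)
    where
    π : A ∷ List* ∷ Elˡ X ∷ [] ↭ Elˡ X ∷ List* ∷ A ∷ []
    π = trans (swap A List* refl)
          (trans (prep List* (swap A (Elˡ X) refl)) (swap List* (Elˡ X) refl))

  cons* : [] ⊢ A ⊸ List* ⊸ List*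
  cons* = ƛ (ƛ (Λ λ X → ƛ (ƛ (let! var (λ c′ → consBody X (μ c′))))))

  Alg : Ty
  Alg = Σ U (λ X → M (Elˡ X) × M (! Step (Elˡ X)))

  alg : (X : Tm U) → [] ⊢ Elˡ X → [] ⊢ Step (Elˡ X) → Tm Alg
  alg X n c = pair X (pair (𝕞 n) (𝕞 (bang c)))

  code : Tm Alg → Tm U
  code X = fst X

  ∣_∣ : Tm Alg → LTy
  ∣ X ∣ = Elˡ (code X)

  nilOf : (X : Tm Alg) → [] ⊢ ∣ X ∣
  nilOf X = μ (fst (snd X))

  -- The structure map c_X is the function underlying the component of type
  -- !(A ⊸ X ⊸ X); it is promoted again where a term of that type is needed
  -- (recAlg).  A closed term of type ! B need not be a promotion, and morphisms
  -- only see the underlying functions, so that φ and ψ would not agree on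
  -- cons*(a,l) if recAlg used the component of type !(A ⊸ X ⊸ X) itself.
  consOf : (X : Tm Alg) → [] ⊢ Step ∣ X ∣
  consOf X = derelict (μ (snd (snd X)))

  isMor : (X Y : Tm Alg) → Tm (M (∣ X ∣ ⊸ ∣ Y ∣)) → Ty
  isMor X Y f =
    (μ f $ nilOf X =ᴸ nilOf Y) ×
    Π (M A) λ a → Π (M ∣ X ∣) λ x →
      μ f $ (consOf X $ μ a $ μ x) =ᴸ consOf Y $ μ a $ (μ f $ μ x)

  Mor : Tm Alg → Tm Alg → Ty
  Mor X Y = Σ (M (∣ X ∣ ⊸ ∣ Y ∣)) (isMor X Y)

  ⌊_⌋ : ∀ {X Y} → Tm (Mor X Y) → [] ⊢ ∣ X ∣ ⊸ ∣ Y ∣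
  ⌊ m ⌋ = μ (fst m)

  recAlg : ∀ {Ξ} (X : Tm Alg) → Ξ ⊢ List* → (Ξ ++ []) ++ [] ⊢ ∣ X ∣
  recAlg X l = rec (code X) (nilOf X) (bang (consOf X)) l

  Target : LTy
  Target = Πˡ Alg λ X → Πˡ Alg λ Y → Πˡ (Mor X Y) λ _ → ∣ Y ∣

  φ ψ : [] ⊢ List* ⊸ Target
  φ = ƛ (Λ λ X → Λ λ Y → Λ λ f → ⌊ f ⌋ $ recAlg X var)
  ψ = ƛ (Λ λ X → Λ λ Y → Λ λ f → recAlg Y var)

  ListA : LTy
  ListA = Eq φ ψ

  recAlg-var : ∀ X l → recAlg X var ⟪ l ∷ [] ⟫ ≡ recAlg X l
  recAlg-var X l = begin
    recAlg X var ⟪ l ∷ [] ⟫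
      ≡⟨ $-⟪⟫ (var · code X $ nilOf X) c (l ∷ []) [] ⟩
    (var · code X $ nilOf X) ⟪ l ∷ [] ⟫ $ c ⟪ [] ⟫
      ≡⟨ cong₂ _$_ ($-⟪⟫ (var · code X) (nilOf X) (l ∷ []) []) (⟪[]⟫ c) ⟩
    (var · code X) ⟪ l ∷ [] ⟫ $ nilOf X ⟪ [] ⟫ $ c
      ≡⟨ cong (_$ c) (cong₂ _$_ (·-⟪⟫ var (code X) (l ∷ [])) (⟪[]⟫ (nilOf X))) ⟩
    var ⟪ l ∷ [] ⟫ · code X $ nilOf X $ c
      ≡⟨ cong (λ v → recAlg X v) (var-⟪⟫ l) ⟩
    recAlg X l ∎
    where c = bang (consOf X)

  target-β : (t : (X Y : Tm Alg) → Tm (Mor X Y) → [ List* ] ⊢ ∣ Y ∣) → ∀ l X Y m →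
             (ƛ (Λ λ X → Λ λ Y → Λ (t X Y)) $ l) · X · Y · m ≡ t X Y m ⟪ l ∷ [] ⟫
  target-β t l X Y m = begin
    (ƛ t₃ $ l) · X · Y · m
      ≡⟨ cong (λ u → u · X · Y · m) (β t₃ l) ⟩
    t₃ ⟪ l ∷ [] ⟫ · X · Y · m
      ≡⟨ cong (λ u → u · Y · m) (Πˡ-β-⟪⟫ C₃ t₂ (l ∷ []) X) ⟩
    t₂ X ⟪ l ∷ [] ⟫ · Y · m
      ≡⟨ cong (_· m) (Πˡ-β-⟪⟫ (C₂ X) (t₁ X) (l ∷ []) Y) ⟩
    t₁ X Y ⟪ l ∷ [] ⟫ · m
      ≡⟨ Πˡ-β-⟪⟫ (C₁ X Y) (t X Y) (l ∷ []) m ⟩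
    t X Y m ⟪ l ∷ [] ⟫ ∎
    where
    C₁ : (X Y : Tm Alg) → Tm (Mor X Y) → LTy
    C₁ X Y _ = ∣ Y ∣
    C₂ : (X Y : Tm Alg) → LTy
    C₂ X Y = Πˡ (Mor X Y) (C₁ X Y)
    C₃ : Tm Alg → LTy
    C₃ X = Πˡ Alg (C₂ X)
    t₁ : (X Y : Tm Alg) → [ List* ] ⊢ C₂ X Y
    t₁ X Y = Λ (t X Y)
    t₂ : (X : Tm Alg) → [ List* ] ⊢ C₃ X
    t₂ X = Λ (t₁ X)
    t₃ : [ List* ] ⊢ Target
    t₃ = Λ t₂

  φ-β : ∀ l X Y (m : Tm (Mor X Y)) → (φ $ l) · X · Y · m ≡ ⌊ m ⌋ $ recAlg X l
  φ-β l X Y m = begin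
    (φ $ l) · X · Y · m                 ≡⟨ target-β (λ X Y f → ⌊ f ⌋ $ recAlg X var) l X Y m ⟩
    (⌊ m ⌋ $ recAlg X var) ⟪ l ∷ [] ⟫   ≡⟨ closed$-⟪⟫ _ _ _ ⟩
    ⌊ m ⌋ $ recAlg X var ⟪ l ∷ [] ⟫     ≡⟨ cong (⌊ m ⌋ $_) (recAlg-var X l) ⟩
    ⌊ m ⌋ $ recAlg X l                  ∎

  ψ-β : ∀ l X Y (m : Tm (Mor X Y)) → (ψ $ l) · X · Y · m ≡ recAlg Y l
  ψ-β l X Y m = begin
    (ψ $ l) · X · Y · m       ≡⟨ target-β (λ X Y f → recAlg Y var) l X Y m ⟩
    recAlg Y var ⟪ l ∷ [] ⟫   ≡⟨ recAlg-var Y l ⟩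
    recAlg Y l                ∎

  natural : ∀ {l} → φ $ l ≡ ψ $ l → ∀ {X Y} (m : Tm (Mor X Y)) →
            ⌊ m ⌋ $ recAlg X l ≡ recAlg Y l
  natural {l} p {X} {Y} m = begin
    ⌊ m ⌋ $ recAlg X l     ≡⟨ sym (φ-β l X Y m) ⟩
    (φ $ l) · X · Y · m    ≡⟨ cong (λ u → u · X · Y · m) p ⟩
    (ψ $ l) · X · Y · m    ≡⟨ ψ-β l X Y m ⟩
    recAlg Y l             ∎

  natural⁻¹ : ∀ {l} → (∀ {X Y} (m : Tm (Mor X Y)) → ⌊ m ⌋ $ recAlg X l ≡ recAlg Y l) →
              φ $ l ≡ ψ $ l
  natural⁻¹ {l} h = Πˡ-ext λ X → Πˡ-ext λ Y → Πˡ-ext λ m → begin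
    (φ $ l) · X · Y · m    ≡⟨ φ-β l X Y m ⟩
    ⌊ m ⌋ $ recAlg X l     ≡⟨ h m ⟩
    recAlg Y l             ≡⟨ sym (ψ-β l X Y m) ⟩
    (ψ $ l) · X · Y · m    ∎

  mor-nil : ∀ {X Y} (m : Tm (Mor X Y)) → ⌊ m ⌋ $ nilOf X ≡ nilOf Y
  mor-nil m = 𝕞-inj (reflect (fst (snd m)))

  mor-cons : ∀ {X Y} (m : Tm (Mor X Y)) a x →
             ⌊ m ⌋ $ (consOf X $ a $ x) ≡ consOf Y $ a $ (⌊ m ⌋ $ x)
  mor-cons {X} {Y} m a x = begin
    ⌊ m ⌋ $ (consOf X $ a $ x)
      ≡⟨ cong₂ (λ b y → ⌊ m ⌋ $ (consOf X $ b $ y)) (sym (μ-𝕞 a)) (sym (μ-𝕞 x)) ⟩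
    ⌊ m ⌋ $ (consOf X $ μ (𝕞 a) $ μ (𝕞 x))
      ≡⟨ 𝕞-inj (reflect (snd (snd m) ∙ 𝕞 a ∙ 𝕞 x)) ⟩
    consOf Y $ μ (𝕞 a) $ (⌊ m ⌋ $ μ (𝕞 x))
      ≡⟨ cong₂ (λ b y → consOf Y $ b $ (⌊ m ⌋ $ y)) (μ-𝕞 a) (μ-𝕞 x) ⟩
    consOf Y $ a $ (⌊ m ⌋ $ x) ∎

  rec-nil* : ∀ X n (c : [] ⊢ Step (Elˡ X)) → rec X n (bang c) nil* ≡ n
  rec-nil* X n c = begin
    nil* · X $ n $ bang c
      ≡⟨ cong (λ u → u $ n $ bang c) (Πˡ-β _ X) ⟩
    ƛ (ƛ (let! var (λ _ → var))) $ n $ bang c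
      ≡⟨ β₂ _ n (bang c) ⟩
    let! var (λ _ → var) ⟪ bang c ∷ n ∷ [] ⟫
      ≡⟨ let!-⟪⟫ var (λ _ → var) (bang c ∷ []) (n ∷ []) ⟩
    let! (var ⟪ bang c ∷ [] ⟫) (λ _ → var ⟪ n ∷ [] ⟫)
      ≡⟨ cong (λ s → let! s (λ _ → var ⟪ n ∷ [] ⟫)) (var-⟪⟫ (bang c)) ⟩
    let! (bang c) (λ _ → var ⟪ n ∷ [] ⟫)
      ≡⟨ !-β c (λ _ → var ⟪ n ∷ [] ⟫) ⟩
    var ⟪ n ∷ [] ⟫
      ≡⟨ var-⟪⟫ n ⟩
    n ∎

  consBody-⟪⟫ : ∀ X c a l n →
                consBody X c ⟪ n ∷ l ∷ a ∷ [] ⟫ ≡ c $ a $ rec X n (bang c) l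
  consBody-⟪⟫ X c a l n = begin
    consBody X c ⟪ n ∷ l ∷ a ∷ [] ⟫
      ≡⟨ exch-⟪⟫ _ _ (a ∷ l ∷ n ∷ []) ⟩
    (c $ var $ rec X var (bang c) var) ⟪ a ∷ l ∷ n ∷ [] ⟫
      ≡⟨ $-⟪⟫ (c $ var) (rec X var (bang c) var) (a ∷ []) (l ∷ n ∷ []) ⟩
    (c $ var) ⟪ a ∷ [] ⟫ $ rec X var (bang c) var ⟪ l ∷ n ∷ [] ⟫
      ≡⟨ cong₂ _$_ (closed$-⟪⟫ c var (a ∷ []))
           ($-⟪⟫ (var · X $ var) (bang c) (l ∷ n ∷ []) []) ⟩
    (c $ var ⟪ a ∷ [] ⟫) $ ((var · X $ var) ⟪ l ∷ n ∷ [] ⟫ $ bang c ⟪ [] ⟫)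
      ≡⟨ cong₂ (λ u v → c $ u $ (v $ bang c ⟪ [] ⟫))
           (var-⟪⟫ a) ($-⟪⟫ (var · X) var (l ∷ []) (n ∷ [])) ⟩
    c $ a $ ((var · X) ⟪ l ∷ [] ⟫ $ var ⟪ n ∷ [] ⟫ $ bang c ⟪ [] ⟫)
      ≡⟨ cong₂ (λ u v → c $ a $ (u $ v $ bang c ⟪ [] ⟫))
           (·-⟪⟫ var X (l ∷ [])) (var-⟪⟫ n) ⟩
    c $ a $ (var ⟪ l ∷ [] ⟫ · X $ n $ bang c ⟪ [] ⟫)
      ≡⟨ cong₂ (λ u v → c $ a $ (u · X $ n $ v)) (var-⟪⟫ l) (⟪[]⟫ (bang c)) ⟩
    c $ a $ (l · X $ n $ bang c) ∎

  rec-cons* : ∀ X n (c : [] ⊢ Step (Elˡ X)) a l →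
              rec X n (bang c) (cons* $ a $ l) ≡ c $ a $ rec X n (bang c) l
  rec-cons* X n c a l = begin
    (cons* $ a $ l) · X $ n $ bang c
      ≡⟨ cong (λ u → u · X $ n $ bang c) (β₂ (Λ (λ X → ƛ (ƛ (t X)))) a l) ⟩
    Λ (λ X → ƛ (ƛ (t X))) ⟪ l ∷ a ∷ [] ⟫ · X $ n $ bang c
      ≡⟨ cong (λ u → u $ n $ bang c) (Πˡ-β-⟪⟫ _ (λ X → ƛ (ƛ (t X))) (l ∷ a ∷ []) X) ⟩
    ƛ (ƛ (t X)) ⟪ l ∷ a ∷ [] ⟫ $ n $ bang c
      ≡⟨ cong (_$ bang c) (⊸-β (ƛ (t X)) (l ∷ a ∷ []) n) ⟩
    ƛ (t X) ⟪ n ∷ l ∷ a ∷ [] ⟫ $ bang c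
      ≡⟨ ⊸-β (t X) (n ∷ l ∷ a ∷ []) (bang c) ⟩
    t X ⟪ bang c ∷ n ∷ l ∷ a ∷ [] ⟫
      ≡⟨ let!-⟪⟫ var (λ c′ → consBody X (μ c′)) (bang c ∷ []) (n ∷ l ∷ a ∷ []) ⟩
    let! (var ⟪ bang c ∷ [] ⟫) (λ c′ → consBody X (μ c′) ⟪ n ∷ l ∷ a ∷ [] ⟫)
      ≡⟨ cong (λ s → let! s (λ c′ → consBody X (μ c′) ⟪ n ∷ l ∷ a ∷ [] ⟫)) (var-⟪⟫ (bang c)) ⟩
    let! (bang c) (λ c′ → consBody X (μ c′) ⟪ n ∷ l ∷ a ∷ [] ⟫)
      ≡⟨ !-β c (λ c′ → consBody X (μ c′) ⟪ n ∷ l ∷ a ∷ [] ⟫) ⟩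
    consBody X (μ (𝕞 c)) ⟪ n ∷ l ∷ a ∷ [] ⟫
      ≡⟨ cong (λ c′ → consBody X c′ ⟪ n ∷ l ∷ a ∷ [] ⟫) (μ-𝕞 c) ⟩
    consBody X c ⟪ n ∷ l ∷ a ∷ [] ⟫
      ≡⟨ consBody-⟪⟫ X c a l n ⟩
    c $ a $ rec X n (bang c) l ∎
    where
    t : (X : Tm U) → ! Step (Elˡ X) ∷ Elˡ X ∷ List* ∷ A ∷ [] ⊢ Elˡ X
    t X = let! var (λ c′ → consBody X (μ c′))

  nil-agree : φ $ nil* ≡ ψ $ nil*
  nil-agree = natural⁻¹ λ {X} {Y} m → begin
    ⌊ m ⌋ $ recAlg X nil*   ≡⟨ cong (⌊ m ⌋ $_) (rec-nil* _ _ _) ⟩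
    ⌊ m ⌋ $ nilOf X         ≡⟨ mor-nil m ⟩
    nilOf Y                 ≡⟨ sym (rec-nil* _ _ _) ⟩
    recAlg Y nil*           ∎

  cons-agree : ∀ a {l} → φ $ l ≡ ψ $ l → φ $ (cons* $ a $ l) ≡ ψ $ (cons* $ a $ l)
  cons-agree a {l} p = natural⁻¹ λ {X} {Y} m → begin
    ⌊ m ⌋ $ recAlg X (cons* $ a $ l)       ≡⟨ cong (⌊ m ⌋ $_) (rec-cons* _ _ _ a l) ⟩
    ⌊ m ⌋ $ (consOf X $ a $ recAlg X l)    ≡⟨ mor-cons m a _ ⟩
    consOf Y $ a $ (⌊ m ⌋ $ recAlg X l)    ≡⟨ cong (consOf Y $ a $_) (natural p m) ⟩
    consOf Y $ a $ recAlg Y l              ≡⟨ sym (rec-cons* _ _ _ a l) ⟩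
    recAlg Y (cons* $ a $ l)               ∎

  nil : [] ⊢ ListA
  nil = eq nil* nil-agree

  consTm : ListA ∷ A ∷ [] ⊢ List*
  consTm = exch (swap A ListA refl) (cons* $ var $ ι var)

  consTm-⟪⟫ : ∀ l a → consTm ⟪ l ∷ a ∷ [] ⟫ ≡ cons* $ a $ ι l
  consTm-⟪⟫ l a = begin
    consTm ⟪ l ∷ a ∷ [] ⟫
      ≡⟨ exch-⟪⟫ _ _ (a ∷ l ∷ []) ⟩
    (cons* $ var $ ι var) ⟪ a ∷ l ∷ [] ⟫
      ≡⟨ $-⟪⟫ (cons* $ var) (ι var) (a ∷ []) (l ∷ []) ⟩
    (cons* $ var) ⟪ a ∷ [] ⟫ $ ι var ⟪ l ∷ [] ⟫
      ≡⟨ cong₂ _$_ (closed$-⟪⟫ cons* var _) (ι-⟪⟫ var _) ⟩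
    cons* $ var ⟪ a ∷ [] ⟫ $ ι (var ⟪ l ∷ [] ⟫)
      ≡⟨ cong₂ (λ u v → cons* $ u $ ι v) (var-⟪⟫ a) (var-⟪⟫ l) ⟩
    cons* $ a $ ι l ∎

  consTm-agree : φ $ consTm ≡ ψ $ consTm
  consTm-agree = pointwise λ { (l ∷ a ∷ []) → begin
    (φ $ consTm) ⟪ l ∷ a ∷ [] ⟫    ≡⟨ closed$-⟪⟫ φ consTm _ ⟩
    φ $ consTm ⟪ l ∷ a ∷ [] ⟫      ≡⟨ cong (φ $_) (consTm-⟪⟫ l a) ⟩
    φ $ (cons* $ a $ ι l)          ≡⟨ cons-agree a (Eq-eq l) ⟩
    ψ $ (cons* $ a $ ι l)          ≡⟨ cong (ψ $_) (sym (consTm-⟪⟫ l a)) ⟩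
    ψ $ consTm ⟪ l ∷ a ∷ [] ⟫      ≡⟨ sym (closed$-⟪⟫ ψ consTm _) ⟩
    (ψ $ consTm) ⟪ l ∷ a ∷ [] ⟫    ∎ }

  cons : [] ⊢ A ⊸ ListA ⊸ ListA
  cons = ƛ (ƛ (eq consTm consTm-agree))

  small-ListA : Small ListA
  small-ListA = small-Eq φ ψ
    (small-Πˡ λ X → small-⊸ (small-⊸ (X , refl)))
    (small-Πˡ λ X → small-Πˡ λ Y → small-Πˡ λ _ → code Y , refl)

  -- Elˡ of the code of ListA is only propositionally equal to ListA.
  ListAlg : Tm Alg
  ListAlg = alg (proj₁ small-ListA)
    (subst ([] ⊢_) (sym (proj₂ small-ListA)) nil)
    (subst (λ Z → [] ⊢ Step Z) (sym (proj₂ small-ListA)) cons)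

{-# OPTIONS --safe #-}

-- Every algebra X receives the morphism l ↦ rec(X, n_X, c_X, ι l).  By the
-- equalizer condition on l, a morphism f : List(A) → X sends
-- rec(List(A), nil, cons, ι l) to rec(X, n_X, c_X, ι l), so uniqueness reduces to
-- rec(List(A), nil, cons, ι l) = l.  As ι is monic this can be checked after
-- applying rec(X, n, c, -) for all X, n and c, where it is again the equalizer
-- condition, now for the morphism rec(X, n, c, ι -).
module Submission where

open import Defs

open import Axiom.UniquenessOfIdentityProofs.WithK using (uip)
open import Data.List.Base using ([]; _∷_)
open import Data.List.Relation.Unary.All using ([]; _∷_)
open import Data.Product.Base using (∃-syntax; _,_; proj₁; proj₂) renaming (_×_ to _×ˢ_)
open import Relation.Binary.PropositionalEquality
  using (_≡_; refl; sym; cong; cong₂; dcong₂; subst; trans; module ≡-Reasoning)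

-- Extensionality and proof irrelevance in the type theory.

module LDTTProperties {ℓ} (T : LDTT ℓ) where

  open LDTT T
  open ≡-Reasoning

  -- By η both maps are abstractions of open terms in one variable, and `pointwise` compares those
  -- on closed instances.
  ⊸-ext : ∀ {A B} {f g : [] ⊢ A ⊸ B} → (∀ a → f $ a ≡ g $ a) → f ≡ g
  ⊸-ext {f = f} {g} h = begin
    f             ≡⟨ sym (⊸-η f) ⟩
    ƛ (f $ var)   ≡⟨ cong ƛ (pointwise λ { (a ∷ []) → begin
                       (f $ var) ⟪ a ∷ [] ⟫   ≡⟨ closed$-⟪⟫ f var _ ⟩
                       f $ var ⟪ a ∷ [] ⟫     ≡⟨ h _ ⟩
                       g $ var ⟪ a ∷ [] ⟫     ≡⟨ sym (closed$-⟪⟫ g var _) ⟩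
                       (g $ var) ⟪ a ∷ [] ⟫   ∎ }) ⟩
    ƛ (g $ var)   ≡⟨ ⊸-η g ⟩
    g             ∎

  -- A closed term of `! A` need not be a promotion, but `!-η` unpacks it and leaves both maps
  -- applied to promotions only.
  !-ext : ∀ {A B} {f g : [] ⊢ ! A ⊸ B} → (∀ a → f $ bang a ≡ g $ bang a) → f ≡ g
  !-ext {f = f} {g} h = ⊸-ext λ s → begin
    f $ s                              ≡⟨ sym (!-η f s) ⟩
    let! s (λ x → f $ bang (μ x))      ≡⟨ cong (let! s) (funext λ x → h (μ x)) ⟩
    let! s (λ x → g $ bang (μ x))      ≡⟨ !-η g s ⟩
    g $ s                              ∎

  derelict-bang : ∀ {A} (a : [] ⊢ A) → derelict (bang a) ≡ a
  derelict-bang a = trans (!-β a μ) (μ-𝕞 a)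

  -- By `Eq-η` an element is rebuilt from its image under `ι` and an equation, and equations are
  -- unique by `uip`.
  ι-injective : ∀ {Ξ A B} {f g : [] ⊢ A ⊸ B} {d e : Ξ ⊢ Eq f g} → ι d ≡ ι e → d ≡ e
  ι-injective {f = f} {g} {d} {e} p = begin
    d                  ≡⟨ sym (Eq-η d) ⟩
    eq (ι d) (Eq-eq d) ≡⟨ eq-cong p ⟩
    eq (ι e) (Eq-eq e) ≡⟨ Eq-η e ⟩
    e                  ∎
    where
    eq-cong : ∀ {t u} {p : f $ t ≡ g $ t} {q : f $ u ≡ g $ u} → t ≡ u → eq t p ≡ eq u q
    eq-cong {t} refl = cong (eq t) (uip _ _)

  Prop : Ty → Set ℓ
  Prop B = (x y : Tm B) → x ≡ y

  Σ-ext : ∀ {B C} → (∀ x → Prop (C x)) → {p q : Tm (Σ B C)} → fst p ≡ fst q → p ≡ q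
  Σ-ext prop {p} {q} e = begin
    p                     ≡⟨ sym (Σ-η p) ⟩
    pair (fst p) (snd p)  ≡⟨ dcong₂ pair e (prop _ _ _) ⟩
    pair (fst q) (snd q)  ≡⟨ Σ-η q ⟩
    q                     ∎

  ×-prop : ∀ {B C} → Prop B → Prop C → Prop (B × C)
  ×-prop B-prop C-prop p q = Σ-ext (λ _ → C-prop) (B-prop _ _)

  Π-prop : ∀ {B C} → (∀ x → Prop (C x)) → Prop (Π B C)
  Π-prop prop f g = begin
    f                   ≡⟨ sym (Π-η f) ⟩
    fun (λ x → f ∙ x)   ≡⟨ cong fun (funext λ x → prop x _ _) ⟩
    fun (λ x → g ∙ x)   ≡⟨ Π-η g ⟩
    g                   ∎

  ×-β₂ : ∀ {B C} (x : Tm B) (y : Tm C) → snd (pair {B} {λ _ → C} x y) ≡ y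
  ×-β₂ {C = C} x y = trans (sym (subst-const (Σ-β₁ x y))) (Σ-β₂ x y)
    where
    subst-const : ∀ {B} {x x′ : Tm B} (e : x ≡ x′) {z : Tm C} → subst (λ _ → Tm C) e z ≡ z
    subst-const refl = refl

module Initiality {ℓ} (T : LDTT ℓ) (A : LDTT.LTy T) where

  open LDTT T
  open LDTTProperties T
  open Lists T A
  open ≡-Reasoning

  -- Elements of Alg with the equality Elˡ X ≡ Carrier made explicit, so that
  -- ListA itself, and not only the decoding of its code, can be a carrier.
  record SmallAlg : Set ℓ where
    constructor smallAlg
    field
      Carrier : LTy
      small   : Small Carrier
      nilᴿ    : [] ⊢ Carrier
      consᴿ   : [] ⊢ Step Carrier

  open SmallAlg

  record IsHom (R S : SmallAlg) (f : [] ⊢ Carrier R ⊸ Carrier S) : Set ℓ where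
    field
      hom-nil  : f $ nilᴿ R ≡ nilᴿ S
      hom-cons : (a : [] ⊢ A) (x : [] ⊢ Carrier R) → f $ (consᴿ R $ a $ x) ≡ consᴿ S $ a $ (f $ x)

  open IsHom

  -- Passage between `Alg` and algebras with an explicit carrier.

  elAlg : (X : Tm U) → [] ⊢ Elˡ X → [] ⊢ Step (Elˡ X) → SmallAlg
  elAlg X n c = smallAlg (Elˡ X) (X , refl) n c

  fromAlg : Tm Alg → SmallAlg
  fromAlg X = elAlg (code X) (nilOf X) (consOf X)

  -- `alg` stores the step promoted and `consOf` derelicts it, so `derelict-bang` gives it back.
  fromAlg-alg : ∀ X n c → fromAlg (alg X n c) ≡ elAlg X n c
  fromAlg-alg X n c = begin
    fromAlg (alg X n c)
      ≡⟨ dcong₂ (λ Z d → elAlg Z (μ (fst d)) (derelict (μ (snd d)))) (Σ-β₁ X d) (Σ-β₂ X d) ⟩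
    elAlg X (μ (fst d)) (derelict (μ (snd d)))
      ≡⟨ cong₂ (λ y z → elAlg X (μ y) (derelict (μ z))) (Σ-β₁ _ _) (×-β₂ _ _) ⟩
    elAlg X (μ (𝕞 n)) (derelict (μ (𝕞 (bang c))))
      ≡⟨ cong₂ (λ y z → elAlg X y (derelict z)) (μ-𝕞 n) (μ-𝕞 (bang c)) ⟩
    elAlg X n (derelict (bang c))
      ≡⟨ cong (elAlg X n) (derelict-bang c) ⟩
    elAlg X n c ∎
    where
    d : Tm (M (Elˡ X) × M (! Step (Elˡ X)))
    d = pair (𝕞 n) (𝕞 (bang c))

  toMor : ∀ {X Y} {f : [] ⊢ ∣ X ∣ ⊸ ∣ Y ∣} → IsHom (fromAlg X) (fromAlg Y) f → Tm (Mor X Y)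
  toMor {X} {Y} {f} h = pair (𝕞 f) (subst (λ g → Tm (laws g)) (sym (μ-𝕞 f))
    (pair (≡⇒=ᴸ (hom-nil h)) (fun λ a → fun λ x → ≡⇒=ᴸ (hom-cons h (μ a) (μ x)))))
    where
    -- This is `isMor` with the underlying map abstracted: the laws are proved for `f`, but the pair
    -- needs them for `μ (𝕞 f)`.
    laws : [] ⊢ ∣ X ∣ ⊸ ∣ Y ∣ → Ty
    laws g = (g $ nilOf X =ᴸ nilOf Y) ×
      Π (M A) λ a → Π (M ∣ X ∣) λ x →
        g $ (consOf X $ μ a $ μ x) =ᴸ consOf Y $ μ a $ (g $ μ x)
    ≡⇒=ᴸ : ∀ {B} {t u : [] ⊢ B} → t ≡ u → Tm (t =ᴸ u)
    ≡⇒=ᴸ refl = rfl _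

  ⌊toMor⌋ : ∀ {X Y} {f : [] ⊢ ∣ X ∣ ⊸ ∣ Y ∣} (h : IsHom (fromAlg X) (fromAlg Y) f) →
            ⌊ toMor {X} {Y} h ⌋ ≡ f
  ⌊toMor⌋ {f = f} h = trans (cong μ (Σ-β₁ _ _)) (μ-𝕞 f)

  ⌊⌋-isHom : ∀ {X Y} (m : Tm (Mor X Y)) → IsHom (fromAlg X) (fromAlg Y) ⌊ m ⌋
  ⌊⌋-isHom m = record { hom-nil = mor-nil m ; hom-cons = mor-cons m }

  -- The laws are built from identity types, whose proofs are unique by `Id-η`, so only the map
  -- counts.
  Mor-ext : ∀ {X Y} {m m′ : Tm (Mor X Y)} → ⌊ m ⌋ ≡ ⌊ m′ ⌋ → m ≡ m′
  Mor-ext {m = m} {m′} e = Σ-ext isMor-prop (begin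
    fst m          ≡⟨ sym (𝕞-μ _) ⟩
    𝕞 ⌊ m ⌋        ≡⟨ cong 𝕞 e ⟩
    𝕞 ⌊ m′ ⌋       ≡⟨ 𝕞-μ _ ⟩
    fst m′         ∎)
    where
    isMor-prop : ∀ f → Prop (isMor _ _ f)
    isMor-prop f = ×-prop Id-η (Π-prop λ a → Π-prop λ x → Id-η)

  -- Recursion into an algebra and its naturality.

  recᴿ : (R : SmallAlg) → [] ⊢ List* → [] ⊢ Carrier R
  recᴿ (smallAlg _ (X , refl) n c) l = rec X n (bang c) l

  -- Matching `refl` turns each carrier into a decoded code; the algebra is then `fromAlg` of an
  -- `alg`, where the condition on `l` is `natural`.
  naturalᴿ : ∀ {l} → φ $ l ≡ ψ $ l → ∀ R S {f} → IsHom R S f → f $ recᴿ R l ≡ recᴿ S l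
  naturalᴿ {l} p (smallAlg _ (X , refl) n c) (smallAlg _ (Y , refl) n′ c′) {f} h =
    transport (fromAlg-alg X n c) (fromAlg-alg Y n′ c′) (λ _ → natural-fromAlg) f h
    where
    -- The map is quantified inside, so that its type moves with the algebras under `transport`.
    Natural : SmallAlg → SmallAlg → Set ℓ
    Natural R S = ∀ f → IsHom R S f → f $ recᴿ R l ≡ recᴿ S l
    natural-fromAlg : ∀ {X Y f} → IsHom (fromAlg X) (fromAlg Y) f →
                      f $ recAlg X l ≡ recAlg Y l
    natural-fromAlg {X} {Y} {f} h = begin
      f $ recAlg X l              ≡⟨ cong (_$ recAlg X l) (sym (⌊toMor⌋ h)) ⟩
      ⌊ toMor h ⌋ $ recAlg X l    ≡⟨ natural p (toMor h) ⟩
      recAlg Y l                  ∎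
    transport : ∀ {R R′ S S′} → R ≡ R′ → S ≡ S′ → Natural R S → Natural R′ S′
    transport refl refl x = x

  -- Impredicativity enters here: `ListA` quantifies over all of `U` and still has a code in `U`, so
  -- a list can be eliminated into `ListA` itself.
  ListR : SmallAlg
  ListR = smallAlg ListA small-ListA nil cons

  fromAlg-ListAlg : fromAlg ListAlg ≡ ListR
  fromAlg-ListAlg = trans (fromAlg-alg _ _ _) (transported small-ListA nil cons)
    where
    -- With `L` and `s` as variables, the equality in `s` can be matched with `refl`, which removes
    -- both transports.
    transported : ∀ {L} (s : Small L) (n : [] ⊢ L) (c : [] ⊢ Step L) →
      elAlg (proj₁ s) (subst ([] ⊢_) (sym (proj₂ s)) n)
                      (subst (λ Z → [] ⊢ Step Z) (sym (proj₂ s)) c)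
        ≡ smallAlg L s n c
    transported (X , refl) n c = refl

  -- Folding over a list, and existence of morphisms.

  ι-cons : ∀ a l → ι (cons $ a $ l) ≡ cons* $ a $ ι l
  ι-cons a l = begin
    ι (cons $ a $ l)                             ≡⟨ cong ι (β₂ (eq consTm consTm-agree) a l) ⟩
    ι (eq consTm consTm-agree ⟪ l ∷ a ∷ [] ⟫)    ≡⟨ sym (ι-⟪⟫ _ _) ⟩
    ι (eq consTm consTm-agree) ⟪ l ∷ a ∷ [] ⟫    ≡⟨ cong _⟪ l ∷ a ∷ [] ⟫ (Eq-β _ _) ⟩
    consTm ⟪ l ∷ a ∷ [] ⟫                        ≡⟨ consTm-⟪⟫ l a ⟩
    cons* $ a $ ι l                              ∎

  fold : (X : Tm U) → [] ⊢ Elˡ X → [] ⊢ Step (Elˡ X) → [] ⊢ ListA ⊸ Elˡ X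
  fold X n c = ƛ (rec X n (bang c) (ι var))

  fold-β : ∀ X n c l → fold X n c $ l ≡ rec X n (bang c) (ι l)
  fold-β X n c l = begin
    fold X n c $ l
      ≡⟨ β _ l ⟩
    (ι var · X $ n $ bang c) ⟪ l ∷ [] ⟫
      ≡⟨ $-⟪⟫ (ι var · X $ n) (bang c) (l ∷ []) [] ⟩
    (ι var · X $ n) ⟪ l ∷ [] ⟫ $ bang c ⟪ [] ⟫
      ≡⟨ cong₂ _$_ ($-⟪⟫ (ι var · X) n (l ∷ []) []) (⟪[]⟫ (bang c)) ⟩
    (ι var · X) ⟪ l ∷ [] ⟫ $ n ⟪ [] ⟫ $ bang c
      ≡⟨ cong₂ (λ u v → u $ v $ bang c) (·-⟪⟫ (ι var) X (l ∷ [])) (⟪[]⟫ n) ⟩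
    ι var ⟪ l ∷ [] ⟫ · X $ n $ bang c
      ≡⟨ cong (λ u → u · X $ n $ bang c) (ι-⟪⟫ var (l ∷ [])) ⟩
    ι (var ⟪ l ∷ [] ⟫) · X $ n $ bang c
      ≡⟨ cong (λ u → ι u · X $ n $ bang c) (var-⟪⟫ l) ⟩
    ι l · X $ n $ bang c ∎

  fold-isHom : ∀ X n c → IsHom ListR (elAlg X n c) (fold X n c)
  fold-isHom X n c = record
    { hom-nil = begin
        fold X n c $ nil             ≡⟨ fold-β X n c nil ⟩
        rec X n (bang c) (ι nil)     ≡⟨ cong (λ u → rec X n (bang c) u) (Eq-β _ _) ⟩
        rec X n (bang c) nil*        ≡⟨ rec-nil* X n c ⟩
        n                            ∎
    ; hom-cons = λ a l → begin
        fold X n c $ (cons $ a $ l)              ≡⟨ fold-β X n c _ ⟩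
        rec X n (bang c) (ι (cons $ a $ l))      ≡⟨ cong (λ u → rec X n (bang c) u) (ι-cons a l) ⟩
        rec X n (bang c) (cons* $ a $ ι l)       ≡⟨ rec-cons* X n c a (ι l) ⟩
        c $ a $ rec X n (bang c) (ι l)           ≡⟨ cong (c $ a $_) (sym (fold-β X n c l)) ⟩
        c $ a $ (fold X n c $ l)                 ∎
    }

  -- Uniqueness of morphisms out of lists.

  recᴿ-ListR : ∀ l → recᴿ ListR (ι l) ≡ l
  recᴿ-ListR l = ι-injective (Πˡ-ext λ X → ⊸-ext λ n → !-ext λ c → begin
    rec X n (bang c) (ι (recᴿ ListR (ι l)))
      ≡⟨ sym (fold-β X n c _) ⟩
    fold X n c $ recᴿ ListR (ι l)
      ≡⟨ naturalᴿ (Eq-eq l) ListR (elAlg X n c) (fold-isHom X n c) ⟩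
    rec X n (bang c) (ι l) ∎)

  -- The right-hand side does not mention `f`, so any two morphisms from `ListR` to `S` agree on
  -- closed lists.
  isHom-unique : ∀ {S f} → IsHom ListR S f → ∀ l → f $ l ≡ recᴿ S (ι l)
  isHom-unique {S} {f} h l = begin
    f $ l                        ≡⟨ cong (f $_) (sym (recᴿ-ListR l)) ⟩
    f $ recᴿ ListR (ι l)         ≡⟨ naturalᴿ (Eq-eq l) ListR S h ⟩
    recᴿ S (ι l)                 ∎

  -- Initiality, externally and as contractibility of `Mor`.

  Initial : SmallAlg → Set ℓ
  Initial R = ∀ X → ∃[ f ] (IsHom R (fromAlg X) f ×ˢ
                            (∀ g → IsHom R (fromAlg X) g → g ≡ f))

  ListR-initial : Initial ListR
  ListR-initial X = fold (code X) (nilOf X) (consOf X) , isHom ,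
    λ g h → ⊸-ext λ l → trans (isHom-unique h l) (sym (isHom-unique isHom l))
    where
    isHom = fold-isHom (code X) (nilOf X) (consOf X)

  initial⇒isContr : ∀ {X Y} → Initial (fromAlg X) → Tm (isContr (Mor X Y))
  initial⇒isContr {X} {Y} init with init Y
  ... | f , h , unique = pair (toMor h) (fun λ m → ≡⇒Id (Mor-ext (begin
    ⌊ m ⌋         ≡⟨ unique ⌊ m ⌋ (⌊⌋-isHom m) ⟩
    f             ≡⟨ sym (⌊toMor⌋ h) ⟩
    ⌊ toMor h ⌋   ∎)))
    where
    ≡⇒Id : ∀ {B} {x y : Tm B} → x ≡ y → Tm (Id x y)
    ≡⇒Id refl = rfl _

theorem5p2 : ∀ {ℓ} (T : LDTT ℓ) (A : LDTT.LTy T) →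
    let open LDTT T
        open Lists T A
    in Tm (Π Alg (λ X → isContr (Mor ListAlg X)))
-- Initiality is proved for `ListR`, whose carrier is `ListA`, and moved to `ListAlg`, whose carrier
-- is a decoded code.
theorem5p2 T A = fun λ X → initial⇒isContr (subst Initial (sym fromAlg-ListAlg) ListR-initial)
  where
  open LDTT T
  open Initiality T A
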